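{- For every $k\geq 1$, $\mathsf{TT}^1_k \leq_{\mathrm{W}} \mathsf{D}^2_k$.
   Context: A problem is a partial multivalued function from $\omega^\omega$ to $\omega^\omega$ with nonempty solution sets on its domain (its instances); objects are coded in $\omega^\omega$ via standard codings. $\mathsf{P} \leq_{\mathrm{W}} \mathsf{Q}$ means there are Turing functionals $\Phi,\Psi$ such that for every instance $x$ of $\mathsf{P}$, $\Phi(x)$ is an instance of $\mathsf{Q}$, and for every $\mathsf{Q}$-solution $y$ of $\Phi(x)$, $\Psi(x\oplus y)$ is a $\mathsf{P}$-solution of $x$. $\mathsf{TT}^1_k$: instances are all $f:2^{<\omega}\to k$, solutions all $H\subseteq 2^{<\omega}$ with $(H,\preceq)$ order-isomorphic to $(2^{<\omega},\preceq)$ ($\preceq$ the prefix order) and $f$ constant on $H$. $\mathsf{D}^2_k$ is the jump of $\mathsf{RT}^1_k$: its instances are all functions $g:\omega\times\omega\to k$ such that $\lim_y g(x,y)$ exists for every $x$, and its solutions are all infinite $M\subseteq\omega$ on which the limit coloring $x\mapsto\lim_y g(x,y)$ is constant (equivalently, instances are pairs $(X,h)$ with $h:\omega\to k$ computable from $X'$, given via a limit approximation). -}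

module Defs where

open import Data.Nat using (ℕ; zero; suc; _+_; _*_; _≤_; _<_)
open import Data.Fin using (Fin)
open import Data.Vec using (Vec; []; _∷_; lookup)
open import Data.List using (List; []; _∷_; _++_)
open import Data.Bool using (Bool; true; false)
open import Data.Product using (Σ; ∃; ∃-syntax; _×_; _,_)
open import Relation.Binary.PropositionalEquality using (_≡_)
open import Function.Bundles using (_⇔_)

-- Turing functionals: partial recursive functionals relative to an
-- oracle α : ℕ → ℕ (μ-recursive functions with an oracle basic function).

data Code : ℕ → Set where
  zer  : ∀ {n} → Code n
  succ : Code 1
  proj : ∀ {n} → Fin n → Code n
  orc  : Code 1
  comp : ∀ {m n} → Code m → Vec (Code n) m → Code n
  prec : ∀ {n} → Code n → Code (suc (suc n)) → Code (suc n)
  mu   : ∀ {n} → Code (suc n) → Code n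

mutual
  data Eval (α : ℕ → ℕ) : ∀ {n} → Code n → Vec ℕ n → ℕ → Set where
    e-zer  : ∀ {n} {xs : Vec ℕ n} → Eval α zer xs 0
    e-succ : ∀ {x} → Eval α succ (x ∷ []) (suc x)
    e-proj : ∀ {n} {i : Fin n} {xs} → Eval α (proj i) xs (lookup xs i)
    e-orc  : ∀ {x} → Eval α orc (x ∷ []) (α x)
    e-comp : ∀ {m n} {f : Code m} {gs : Vec (Code n) m} {xs ys v} →
             EvalAll α xs gs ys → Eval α f ys v → Eval α (comp f gs) xs v
    e-prec0 : ∀ {n} {f : Code n} {g} {xs v} →
             Eval α f xs v → Eval α (prec f g) (0 ∷ xs) v
    e-precS : ∀ {n} {f : Code n} {g} {y xs r v} →
             Eval α (prec f g) (y ∷ xs) r → Eval α g (y ∷ r ∷ xs) v →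
             Eval α (prec f g) (suc y ∷ xs) v
    e-mu   : ∀ {n} {f : Code (suc n)} {xs v} →
             EvalMu α f xs 0 v → Eval α (mu f) xs v

  data EvalAll (α : ℕ → ℕ) {n : ℕ} (xs : Vec ℕ n) : ∀ {m} → Vec (Code n) m → Vec ℕ m → Set where
    []  : EvalAll α xs [] []
    _∷_ : ∀ {m} {g : Code n} {gs : Vec (Code n) m} {y ys} →
          Eval α g xs y → EvalAll α xs gs ys → EvalAll α xs (g ∷ gs) (y ∷ ys)

  data EvalMu (α : ℕ → ℕ) {n : ℕ} (f : Code (suc n)) (xs : Vec ℕ n) : ℕ → ℕ → Set where
    mu-here : ∀ {i} → Eval α f (i ∷ xs) 0 → EvalMu α f xs i i
    mu-next : ∀ {i r v} → Eval α f (i ∷ xs) (suc r) → EvalMu α f xs (suc i) v →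
              EvalMu α f xs i v

-- A Turing functional is given by a code of arity 1: Φ(x)(n) = c^x(n).
-- Φ(x) = z  (in particular Φ(x) is total):
Computes : Code 1 → (ℕ → ℕ) → (ℕ → ℕ) → Set
Computes c x z = ∀ n → Eval x c (n ∷ []) (z n)

_⊕_ : (ℕ → ℕ) → (ℕ → ℕ) → (ℕ → ℕ)
(x ⊕ y) zero = x 0
(x ⊕ y) (suc zero) = y 0
(x ⊕ y) (suc (suc n)) = ((λ m → x (suc m)) ⊕ (λ m → y (suc m))) n

IsSetCode : (ℕ → ℕ) → Set
IsSetCode y = ∀ n → y n ≤ 1

_∈ˢ_ : ℕ → (ℕ → ℕ) → Set
n ∈ˢ y = y n ≡ 1

-- bijective coding of binary strings 2^{<ω} by natural numbers
encode : List Bool → ℕ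
encode [] = 0
encode (false ∷ s) = 1 + 2 * encode s
encode (true ∷ s) = 2 + 2 * encode s

-- Cantor pairing ℕ × ℕ → ℕ (a bijection)
tri : ℕ → ℕ
tri zero = zero
tri (suc n) = suc n + tri n

pair : ℕ → ℕ → ℕ
pair a b = tri (a + b) + b

_⪯_ : List Bool → List Bool → Set
σ ⪯ τ = ∃[ ρ ] σ ++ ρ ≡ τ

-- instance: x codes f : 2^{<ω} → k via f(σ) = x(encode σ)
TTInstance : ℕ → (ℕ → ℕ) → Set
TTInstance k x = ∀ n → x n < k

_∈H_ : List Bool → (ℕ → ℕ) → Set
σ ∈H w = encode σ ∈ˢ w

TreeIso : (ℕ → ℕ) → Set
TreeIso w = Σ (List Bool → List Bool) λ h →
    (∀ σ → h σ ∈H w)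
  × (∀ τ → τ ∈H w → ∃[ σ ] h σ ≡ τ)
  × (∀ σ τ → (σ ⪯ τ) ⇔ (h σ ⪯ h τ))

TTSolution : ℕ → (ℕ → ℕ) → (ℕ → ℕ) → Set
TTSolution k x w = IsSetCode w × TreeIso w ×
  (∃[ c ] ∀ σ → σ ∈H w → x (encode σ) ≡ c)

LimIs : (ℕ → ℕ) → ℕ → ℕ → Set
LimIs z a c = ∃[ N ] ∀ y → N ≤ y → z (pair a y) ≡ c

D2Instance : ℕ → (ℕ → ℕ) → Set
D2Instance k z = (∀ n → z n < k) × (∀ a → ∃[ c ] LimIs z a c)

D2Solution : ℕ → (ℕ → ℕ) → (ℕ → ℕ) → Set
D2Solution k z y = IsSetCode y
  × (∀ n → ∃[ m ] n < m × m ∈ˢ y)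
  × (∃[ c ] ∀ a → a ∈ˢ y → LimIs z a c)

TT≤WD2 : ℕ → Set
TT≤WD2 k = Σ (Code 1) λ Φ → Σ (Code 1) λ Ψ →
  ∀ x → TTInstance k x →
    Σ (ℕ → ℕ) λ z → Computes Φ x z × D2Instance k z ×
      (∀ y → D2Solution k z y →
         Σ (ℕ → ℕ) λ w → Computes Ψ (x ⊕ y) w × TTSolution k x w)

{-# OPTIONS --safe #-}
module Submission where

open import Defs
open import Level using (0ℓ)
open import Axiom.ExcludedMiddle using (ExcludedMiddle)
open import Data.Bool using (Bool; true; false)
open import Data.Fin using (Fin; zero; suc)
open import Data.List using (List; []; _∷_; _++_; length)
open import Data.List.Properties using (++-assoc; ++-identityʳ; ++-cancelˡ; ∷-injective)
open import Data.Nat using (ℕ; zero; suc; _+_; _*_; _^_; _∸_; _⊔_; _≤_; _<_; _≟_; z≤n; s≤s)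
open import Data.Nat.Properties
open import Data.Nat.Solver using (module +-*-Solver)
open import Data.Product using (∃-syntax; _×_; _,_; proj₁; proj₂)
open import Data.Sum using (_⊎_; inj₁; inj₂)
open import Data.Vec using (Vec; []; _∷_; lookup; tabulate)
open import Function using (_∘_)
open import Function.Bundles using (_⇔_; mk⇔)
open import Relation.Binary.PropositionalEquality
open import Relation.Nullary using (¬_; Dec; yes; no; contradiction; ¬?; _×-dec_)
open import Relation.Nullary.Decidable using (decidable-stable)
open import Relation.Unary using (Decidable)
open +-*-Solver using (solve; con; _:+_; _:*_; _:=_)

-- Let T₀(s) be the root and T_{i+1}(s) the least τ ⪰ T_i(s) above which at most k − (i + 1) colours
-- have been seen by stage s.  If T_0, …, T_i converge but T_{i+1} does not, then every colour
-- occurring above lim T_i occurs above each of its extensions.  Colour m with the least i < k − 1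
-- such that T_{i+1} changes after stage m, or with k − 1 if there is none: this is a limit
-- colouring, and its only colour used infinitely often is the last convergent level i.  Hence every
-- element m of a homogeneous set has T_i(m) = lim T_i, and although i is not known, the top node
-- t = T_{k-1}(m) lies above T_i(m), so the colour of t is dense above t.  A copy of the full binary
-- tree is then grown from t by repeatedly passing to the least extension, in the direction of each
-- bit, having the colour of t.

-- Bounded arithmetic with an oracle

natrec : ℕ → (ℕ → ℕ → ℕ) → ℕ → ℕ
natrec b s zero = b
natrec b s (suc n) = s n (natrec b s n)

choose : {P : Set} → Dec P → ℕ → ℕ → ℕ
choose (yes _) a b = a
choose (no _) a b = b

choose-yes : {P : Set} (d : Dec P) {a b : ℕ} → P → choose d a b ≡ a
choose-yes (yes _) p = refl
choose-yes (no ¬p) p = contradiction p ¬p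

choose-no : {P : Set} (d : Dec P) {a b : ℕ} → ¬ P → choose d a b ≡ b
choose-no (yes p) ¬p = contradiction p ¬p
choose-no (no _) _ = refl

module _ {P : ℕ → Set} (P? : Decidable P) where

  -- The value at `n` is `n` itself until a witness turns up and is then frozen at that witness, so
  -- `least B` equal to `B` signals failure. In this form bounded search is an instance of primitive
  -- recursion.
  least : ℕ → ℕ
  least zero = zero
  least (suc n) = choose (P? (least n)) (least n) (suc n)

  count : ℕ → ℕ
  count zero = zero
  count (suc n) = choose (P? n) 1 0 + count n

  least-spec : ∀ B → (∀ j → j < least B → ¬ P j) × (least B < B × P (least B) ⊎ least B ≡ B)
  least-spec zero = (λ _ ()) , inj₂ refl
  least-spec (suc n) with P? (least n) | least-spec n
  ... | yes p | below , inj₁ (lt , _) = below , inj₁ (m≤n⇒m≤1+n lt , p)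
  ... | yes p | below , inj₂ eq = below , inj₁ (s≤s (≤-reflexive eq) , p)
  ... | no ¬p | _ , inj₁ (_ , p) = contradiction p ¬p
  ... | no ¬p | below , inj₂ eq = below′ , inj₂ refl
    where
    below′ : ∀ j → j < suc n → ¬ P j
    below′ j (s≤s j≤n) with m≤n⇒m<n∨m≡n j≤n
    ... | inj₁ j<n = below j (subst (j <_) (sym eq) j<n)
    ... | inj₂ refl = subst (¬_ ∘ P) eq ¬p

  least-≤ : ∀ B → least B ≤ B
  least-≤ B with least-spec B
  ... | _ , inj₁ (lt , _) = <⇒≤ lt
  ... | _ , inj₂ eq = ≤-reflexive eq

  least-minimal : ∀ B {j} → P j → least B ≤ j
  least-minimal B {j} pj = ≮⇒≥ λ j<l → proj₁ (least-spec B) j j<l pj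

  least-holds : ∀ B {j} → j < B → P j → least B < B × P (least B)
  least-holds B {j} j<B pj with least-spec B
  ... | _ , inj₁ r = r
  ... | below , inj₂ eq = contradiction pj (below j (subst (j <_) (sym eq) j<B))

  least-unique : ∀ B {v} → v ≤ B → (v < B → P v) → (∀ j → j < v → ¬ P j) → least B ≡ v
  least-unique B {v} v≤B pv below with m≤n⇒m<n∨m≡n v≤B
  ... | inj₁ v<B = ≤-antisym (least-minimal B (pv v<B))
                     (≮⇒≥ λ l<v → below _ l<v (proj₂ (least-holds B v<B (pv v<B))))
  ... | inj₂ refl with least-spec B
  ...   | _ , inj₁ (lt , p) = contradiction p (below _ lt)
  ...   | _ , inj₂ eq = eq

  exists<? : ∀ B → Dec (∃[ j ] j < B × P j)
  exists<? B with least-spec B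
  ... | _ , inj₁ (lt , p) = yes (_ , lt , p)
  ... | below , inj₂ eq = no λ (j , j<B , pj) → below j (subst (j <_) (sym eq) j<B) pj

  count≤ : ∀ n → count n ≤ n
  count≤ zero = z≤n
  count≤ (suc n) with P? n
  ... | yes _ = s≤s (count≤ n)
  ... | no _ = m≤n⇒m≤1+n (count≤ n)

  count-none : ∀ n → (∀ j → ¬ P j) → count n ≡ 0
  count-none zero none = refl
  count-none (suc n) none with P? n
  ... | yes p = contradiction p (none n)
  ... | no _ = count-none n none

module _ {P Q : ℕ → Set} (P? : Decidable P) (Q? : Decidable Q) (P⇒Q : ∀ j → P j → Q j) where

  count-mono : ∀ n → count P? n ≤ count Q? n
  count-mono zero = z≤n
  count-mono (suc n) with P? n | Q? n
  ... | yes p | yes q = s≤s (count-mono n)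
  ... | yes p | no ¬q = contradiction (P⇒Q n p) ¬q
  ... | no _ | yes _ = m≤n⇒m≤1+n (count-mono n)
  ... | no _ | no _ = count-mono n

  count-strict : ∀ n {c} → c < n → ¬ P c → Q c → count P? n < count Q? n
  count-strict (suc n) {c} (s≤s c≤n) ¬pc qc with m≤n⇒m<n∨m≡n c≤n
  ... | inj₂ refl rewrite choose-no (P? c) {1} {0} ¬pc | choose-yes (Q? c) {1} {0} qc =
          s≤s (count-mono n)
  ... | inj₁ c<n with P? n | Q? n
  ...   | yes p | yes q = s≤s (count-strict n c<n ¬pc qc)
  ...   | yes p | no ¬q = contradiction (P⇒Q n p) ¬q
  ...   | no _ | yes _ = m≤n⇒m≤1+n (count-strict n c<n ¬pc qc)
  ...   | no _ | no _ = count-strict n c<n ¬pc qc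

infix 6 _≐_
infixr 5 _∧_
infixl 7 _⊞_
infixl 8 _⊠_

-- A language of primitive recursive terms and bounded formulas with an oracle. The tower, the limit
-- colouring and the tree are written in it, so that their computability needs a single proof by
-- induction on syntax.
mutual
  data Tm (n : ℕ) : Set where
    var : Fin n → Tm n
    lit : ℕ → Tm n
    _⊞_ _⊠_ : Tm n → Tm n → Tm n
    ask : Tm n → Tm n
    ite : Fm n → Tm n → Tm n → Tm n
    rec : Tm n → Tm (suc (suc n)) → Tm n → Tm n
    search : Tm n → Fm (suc n) → Tm n
    number : Tm n → Fm (suc n) → Tm n
    call : ∀ {m} → Tm m → Vec (Tm n) m → Tm n

  data Fm (n : ℕ) : Set where
    _≐_ : Tm n → Tm n → Fm n
    _∧_ : Fm n → Fm n → Fm n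
    neg : Fm n → Fm n
    some : Tm n → Fm (suc n) → Fm n
    callᶠ : ∀ {m} → Fm m → Vec (Tm n) m → Fm n

module Semantics (x : ℕ → ℕ) where
  mutual
    ⟦_⟧ : ∀ {n} → Tm n → Vec ℕ n → ℕ
    ⟦ var i ⟧ ρ = lookup ρ i
    ⟦ lit a ⟧ ρ = a
    ⟦ s ⊞ t ⟧ ρ = ⟦ s ⟧ ρ + ⟦ t ⟧ ρ
    ⟦ s ⊠ t ⟧ ρ = ⟦ s ⟧ ρ * ⟦ t ⟧ ρ
    ⟦ ask t ⟧ ρ = x (⟦ t ⟧ ρ)
    ⟦ ite φ s t ⟧ ρ = choose (holds? φ ρ) (⟦ s ⟧ ρ) (⟦ t ⟧ ρ)
    ⟦ rec b s t ⟧ ρ = natrec (⟦ b ⟧ ρ) (λ i r → ⟦ s ⟧ (i ∷ r ∷ ρ)) (⟦ t ⟧ ρ)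
    ⟦ search t φ ⟧ ρ = least (λ i → holds? φ (i ∷ ρ)) (⟦ t ⟧ ρ)
    ⟦ number t φ ⟧ ρ = count (λ i → holds? φ (i ∷ ρ)) (⟦ t ⟧ ρ)
    ⟦ call t us ⟧ ρ = ⟦ t ⟧ (⟦ us ⟧* ρ)

    ⟦_⟧* : ∀ {m n} → Vec (Tm n) m → Vec ℕ n → Vec ℕ m
    ⟦ [] ⟧* ρ = []
    ⟦ u ∷ us ⟧* ρ = ⟦ u ⟧ ρ ∷ ⟦ us ⟧* ρ

    Holds : ∀ {n} → Fm n → Vec ℕ n → Set
    Holds (s ≐ t) ρ = ⟦ s ⟧ ρ ≡ ⟦ t ⟧ ρ
    Holds (φ ∧ ψ) ρ = Holds φ ρ × Holds ψ ρ
    Holds (neg φ) ρ = ¬ Holds φ ρ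
    Holds (some t φ) ρ = ∃[ i ] i < ⟦ t ⟧ ρ × Holds φ (i ∷ ρ)
    Holds (callᶠ φ us) ρ = Holds φ (⟦ us ⟧* ρ)

    holds? : ∀ {n} (φ : Fm n) (ρ : Vec ℕ n) → Dec (Holds φ ρ)
    holds? (s ≐ t) ρ = ⟦ s ⟧ ρ ≟ ⟦ t ⟧ ρ
    holds? (φ ∧ ψ) ρ = holds? φ ρ ×-dec holds? ψ ρ
    holds? (neg φ) ρ = ¬? (holds? φ ρ)
    holds? (some t φ) ρ = exists<? (λ i → holds? φ (i ∷ ρ)) (⟦ t ⟧ ρ)
    holds? (callᶠ φ us) ρ = holds? φ (⟦ us ⟧* ρ)

-- Compilation to oracle codes

pattern 0F = zero
pattern 1F = suc zero
pattern 2F = suc (suc zero)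
pattern 3F = suc (suc (suc zero))

pattern v0 = var zero
pattern v1 = var (suc zero)
pattern v2 = var (suc (suc zero))
pattern v3 = var (suc (suc (suc zero)))
pattern v4 = var (suc (suc (suc (suc zero))))
pattern v5 = var (suc (suc (suc (suc (suc zero)))))

constᶜ : ∀ {n} → ℕ → Code n
constᶜ zero = zer
constᶜ (suc a) = comp succ (constᶜ a ∷ [])

plusᶜ timesᶜ monusᶜ eqᶜ : Code 2
plusᶜ = prec (proj 0F) (comp succ (proj 1F ∷ []))
timesᶜ = prec zer (comp plusᶜ (proj 2F ∷ proj 1F ∷ []))

predᶜ isZeroᶜ : Code 1
predᶜ = prec zer (proj 0F)
isZeroᶜ = prec (constᶜ 1) zer

-- monusᶜ subtracts its first argument from its second.
monusᶜ = prec (proj 0F) (comp predᶜ (proj 1F ∷ []))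

eqᶜ = comp isZeroᶜ (comp plusᶜ (monusᶜ ∷ comp monusᶜ (proj 1F ∷ proj 0F ∷ []) ∷ []) ∷ [])

iteᶜ : Code 3
iteᶜ = prec (proj 1F) (proj 2F)

selectᶜ : ∀ {m n} → (Fin m → Fin n) → Vec (Code n) m
selectᶜ f = tabulate (proj ∘ f)

searchᶜ numberᶜ : ∀ {n} → Code (suc n) → Code (suc n)
searchᶜ p = prec zer
  -- `selectᶜ suc` drops the counter, so `p` is tested at the previous value of the search.
  (comp iteᶜ (comp p (selectᶜ suc) ∷ proj 1F ∷ comp succ (proj 0F ∷ []) ∷ []))
numberᶜ p = prec zer
  (comp plusᶜ (comp p (proj 0F ∷ selectᶜ (λ i → suc (suc i))) ∷ proj 1F ∷ []))

-- Queries go through `q` because the function asked about need not be the actual oracle: the second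
-- functional runs on `x ⊕ y` while its terms ask about `x`.
module Compile (q : Code 1) where
  mutual
    compile : ∀ {n} → Tm n → Code n
    compile (var i) = proj i
    compile (lit a) = constᶜ a
    compile (s ⊞ t) = comp plusᶜ (compile s ∷ compile t ∷ [])
    compile (s ⊠ t) = comp timesᶜ (compile s ∷ compile t ∷ [])
    compile (ask t) = comp q (compile t ∷ [])
    compile (ite φ s t) = comp iteᶜ (compileᶠ φ ∷ compile s ∷ compile t ∷ [])
    compile (rec b s t) = comp (prec (compile b) (compile s)) (compile t ∷ selectᶜ (λ i → i))
    compile (search t φ) = comp (searchᶜ (compileᶠ φ)) (compile t ∷ selectᶜ (λ i → i))
    compile (number t φ) = comp (numberᶜ (compileᶠ φ)) (compile t ∷ selectᶜ (λ i → i))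
    compile (call t us) = comp (compile t) (compile* us)

    compile* : ∀ {m n} → Vec (Tm n) m → Vec (Code n) m
    compile* [] = []
    compile* (u ∷ us) = compile u ∷ compile* us

    compileᶠ : ∀ {n} → Fm n → Code n
    compileᶠ (s ≐ t) = comp eqᶜ (compile s ∷ compile t ∷ [])
    compileᶠ (φ ∧ ψ) = comp timesᶜ (compileᶠ φ ∷ compileᶠ ψ ∷ [])
    compileᶠ (neg φ) = comp isZeroᶜ (compileᶠ φ ∷ [])
    -- A witness exists exactly when the search stops short of its bound.
    compileᶠ (some t φ) = comp isZeroᶜ
      (comp eqᶜ (comp (searchᶜ (compileᶠ φ)) (compile t ∷ selectᶜ (λ i → i)) ∷ compile t ∷ []) ∷ [])
    compileᶠ (callᶠ φ us) = comp (compileᶠ φ) (compile* us)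

-- Correctness of the compilation

module _ {α : ℕ → ℕ} where

  e-const : ∀ {n} {ρ : Vec ℕ n} a → Eval α (constᶜ a) ρ a
  e-const zero = e-zer
  e-const (suc a) = e-comp (e-const a ∷ []) e-succ

  e-plus : ∀ a b → Eval α plusᶜ (a ∷ b ∷ []) (a + b)
  e-plus zero b = e-prec0 e-proj
  e-plus (suc a) b = e-precS (e-plus a b) (e-comp (e-proj ∷ []) e-succ)

  e-times : ∀ a b → Eval α timesᶜ (a ∷ b ∷ []) (a * b)
  e-times zero b = e-prec0 e-zer
  e-times (suc a) b = e-precS (e-times a b) (e-comp (e-proj ∷ e-proj ∷ []) (e-plus b (a * b)))

  e-pred : ∀ a → Eval α predᶜ (a ∷ []) (a ∸ 1)
  e-pred zero = e-prec0 e-zer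
  e-pred (suc a) = e-precS (e-pred a) e-proj

  e-isZero : ∀ a → Eval α isZeroᶜ (a ∷ []) (1 ∸ a)
  e-isZero zero = e-prec0 (e-const 1)
  e-isZero (suc zero) = e-precS (e-isZero 0) e-zer
  e-isZero (suc (suc a)) = e-precS (e-isZero (suc a)) e-zer

  e-monus : ∀ a b → Eval α monusᶜ (a ∷ b ∷ []) (b ∸ a)
  e-monus zero b = e-prec0 e-proj
  e-monus (suc a) b = subst (Eval α monusᶜ (suc a ∷ b ∷ []))
    (trans (∸-+-assoc b a 1) (cong (b ∸_) (+-comm a 1)))
    (e-precS (e-monus a b) (e-comp (e-proj ∷ []) (e-pred (b ∸ a))))

  e-eq : ∀ a b → Eval α eqᶜ (a ∷ b ∷ []) (1 ∸ ((b ∸ a) + (a ∸ b)))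
  e-eq a b = e-comp
    (e-comp (e-monus a b ∷ e-comp (e-proj ∷ e-proj ∷ []) (e-monus b a) ∷ []) (e-plus _ _) ∷ [])
    (e-isZero _)

  e-eq-yes : ∀ {a b} → a ≡ b → Eval α eqᶜ (a ∷ b ∷ []) 1
  e-eq-yes {a} refl = subst (Eval α eqᶜ (a ∷ a ∷ []))
    (cong (λ d → 1 ∸ (d + d)) (n∸n≡0 a)) (e-eq a a)

  e-eq-no : ∀ {a b} → a ≢ b → Eval α eqᶜ (a ∷ b ∷ []) 0
  e-eq-no {a} {b} a≢b = subst (Eval α eqᶜ (a ∷ b ∷ [])) (m≤n⇒m∸n≡0 (n≢0⇒n>0 d≢0)) (e-eq a b)
    where
    d≢0 : (b ∸ a) + (a ∸ b) ≢ 0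
    d≢0 d≡0 = a≢b (≤-antisym (m∸n≡0⇒m≤n (m+n≡0⇒n≡0 (b ∸ a) d≡0)) (m∸n≡0⇒m≤n (m+n≡0⇒m≡0 (b ∸ a) d≡0)))

  e-ite-no : ∀ a b → Eval α iteᶜ (0 ∷ a ∷ b ∷ []) b
  e-ite-no a b = e-prec0 e-proj

  e-ite-yes : ∀ a b → Eval α iteᶜ (1 ∷ a ∷ b ∷ []) a
  e-ite-yes a b = e-precS (e-ite-no a b) e-proj

  e-select : ∀ {m n} {ρ : Vec ℕ n} {ρ′ : Vec ℕ m} (f : Fin m → Fin n) →
    (∀ i → lookup ρ (f i) ≡ lookup ρ′ i) → EvalAll α ρ (selectᶜ f) ρ′
  e-select {ρ = ρ} {[]} f eq = []
  e-select {ρ = ρ} {a ∷ ρ′} f eq =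
    subst (Eval α (proj (f zero)) ρ) (eq zero) e-proj ∷ e-select (f ∘ suc) (eq ∘ suc)

  record Decides {n} (c : Code n) (ρ : Vec ℕ n) (P : Set) : Set where
    constructor decides
    field
      accept : P → Eval α c ρ 1
      reject : ¬ P → Eval α c ρ 0
  open Decides public

  module _ {n} {p : Code (suc n)} {ρ : Vec ℕ n} {P : ℕ → Set} (P? : Decidable P)
           (p-ok : ∀ i → Decides p (i ∷ ρ) (P i)) where

    e-search : ∀ B → Eval α (searchᶜ p) (B ∷ ρ) (least P? B)
    e-search zero = e-prec0 e-zer
    e-search (suc B) = e-precS (e-search B) step
      where
      args : EvalAll α (B ∷ least P? B ∷ ρ) (selectᶜ suc) (least P? B ∷ ρ)
      args = e-select suc λ _ → refl
      step : Eval α _ (B ∷ least P? B ∷ ρ) (least P? (suc B))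
      step with P? (least P? B)
      ... | yes h = e-comp (e-comp args (accept (p-ok _) h) ∷ e-proj ∷ e-comp (e-proj ∷ []) e-succ ∷ [])
                           (e-ite-yes _ _)
      ... | no ¬h = e-comp (e-comp args (reject (p-ok _) ¬h) ∷ e-proj ∷ e-comp (e-proj ∷ []) e-succ ∷ [])
                           (e-ite-no _ _)

    e-number : ∀ B → Eval α (numberᶜ p) (B ∷ ρ) (count P? B)
    e-number zero = e-prec0 e-zer
    e-number (suc B) = e-precS (e-number B) step
      where
      args : EvalAll α (B ∷ count P? B ∷ ρ) (proj 0F ∷ selectᶜ (λ i → suc (suc i))) (B ∷ ρ)
      args = e-proj ∷ e-select (λ i → suc (suc i)) λ _ → refl
      step : Eval α _ (B ∷ count P? B ∷ ρ) (count P? (suc B))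
      step with P? B
      ... | yes h = e-comp (e-comp args (accept (p-ok _) h) ∷ e-proj ∷ []) (e-plus _ _)
      ... | no ¬h = e-comp (e-comp args (reject (p-ok _) ¬h) ∷ e-proj ∷ []) (e-plus _ _)

  module _ {q : Code 1} {x : ℕ → ℕ} (q-ok : Computes q α x) where
    open Semantics x
    open Compile q

    e-rec : ∀ {n} {b : Code n} {s ρ} (b₀ : ℕ) (s₀ : ℕ → ℕ → ℕ) →
      Eval α b ρ b₀ → (∀ i r → Eval α s (i ∷ r ∷ ρ) (s₀ i r)) →
      ∀ m → Eval α (prec b s) (m ∷ ρ) (natrec b₀ s₀ m)
    e-rec b₀ s₀ eb es zero = e-prec0 eb
    e-rec b₀ s₀ eb es (suc m) = e-precS (e-rec b₀ s₀ eb es m) (es m _)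

    e-ids : ∀ {n} {ρ : Vec ℕ n} → EvalAll α ρ (selectᶜ (λ i → i)) ρ
    e-ids = e-select _ λ _ → refl

    mutual
      compile-ok : ∀ {n} (t : Tm n) ρ → Eval α (compile t) ρ (⟦ t ⟧ ρ)
      compile-ok (var i) ρ = e-proj
      compile-ok (lit a) ρ = e-const a
      compile-ok (s ⊞ t) ρ = e-comp (compile-ok s ρ ∷ compile-ok t ρ ∷ []) (e-plus _ _)
      compile-ok (s ⊠ t) ρ = e-comp (compile-ok s ρ ∷ compile-ok t ρ ∷ []) (e-times _ _)
      compile-ok (ask t) ρ = e-comp (compile-ok t ρ ∷ []) (q-ok _)
      compile-ok (ite φ s t) ρ with holds? φ ρ
      ... | yes h = e-comp (accept (compileᶠ-ok φ ρ) h ∷ compile-ok s ρ ∷ compile-ok t ρ ∷ []) (e-ite-yes _ _)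
      ... | no ¬h = e-comp (reject (compileᶠ-ok φ ρ) ¬h ∷ compile-ok s ρ ∷ compile-ok t ρ ∷ []) (e-ite-no _ _)
      compile-ok (rec b s t) ρ = e-comp (compile-ok t ρ ∷ e-ids)
        (e-rec _ _ (compile-ok b ρ) (λ i r → compile-ok s (i ∷ r ∷ ρ)) (⟦ t ⟧ ρ))
      compile-ok (search t φ) ρ = e-comp (compile-ok t ρ ∷ e-ids)
        (e-search (λ i → holds? φ (i ∷ ρ)) (λ i → compileᶠ-ok φ (i ∷ ρ)) _)
      compile-ok (number t φ) ρ = e-comp (compile-ok t ρ ∷ e-ids)
        (e-number (λ i → holds? φ (i ∷ ρ)) (λ i → compileᶠ-ok φ (i ∷ ρ)) _)
      compile-ok (call t us) ρ = e-comp (compile*-ok us ρ) (compile-ok t _)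

      compile*-ok : ∀ {m n} (us : Vec (Tm n) m) ρ → EvalAll α ρ (compile* us) (⟦ us ⟧* ρ)
      compile*-ok [] ρ = []
      compile*-ok (u ∷ us) ρ = compile-ok u ρ ∷ compile*-ok us ρ

      compileᶠ-ok : ∀ {n} (φ : Fm n) ρ → Decides (compileᶠ φ) ρ (Holds φ ρ)
      compileᶠ-ok (s ≐ t) ρ = decides
        (λ h → e-comp (compile-ok s ρ ∷ compile-ok t ρ ∷ []) (e-eq-yes h))
        (λ ¬h → e-comp (compile-ok s ρ ∷ compile-ok t ρ ∷ []) (e-eq-no ¬h))
      compileᶠ-ok (φ ∧ ψ) ρ = decides
        (λ (h , h′) → e-comp (accept (compileᶠ-ok φ ρ) h ∷ accept (compileᶠ-ok ψ ρ) h′ ∷ []) (e-times 1 1))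
        λ ¬h → case-∧ (holds? φ ρ) (holds? ψ ρ) ¬h
        where
        case-∧ : Dec (Holds φ ρ) → Dec (Holds ψ ρ) → ¬ (Holds φ ρ × Holds ψ ρ) →
          Eval α (compileᶠ (φ ∧ ψ)) ρ 0
        case-∧ (yes h) (yes h′) ¬h = contradiction (h , h′) ¬h
        case-∧ (yes h) (no ¬h′) _ =
          e-comp (accept (compileᶠ-ok φ ρ) h ∷ reject (compileᶠ-ok ψ ρ) ¬h′ ∷ []) (e-times 1 0)
        case-∧ (no ¬h) (yes h′) _ =
          e-comp (reject (compileᶠ-ok φ ρ) ¬h ∷ accept (compileᶠ-ok ψ ρ) h′ ∷ []) (e-times 0 1)
        case-∧ (no ¬h) (no ¬h′) _ =
          e-comp (reject (compileᶠ-ok φ ρ) ¬h ∷ reject (compileᶠ-ok ψ ρ) ¬h′ ∷ []) (e-times 0 0)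
      compileᶠ-ok (neg φ) ρ = decides
        (λ ¬h → e-comp (reject (compileᶠ-ok φ ρ) ¬h ∷ []) (e-isZero 0))
        λ ¬¬h → case-neg (holds? φ ρ) ¬¬h
        where
        case-neg : Dec (Holds φ ρ) → ¬ ¬ Holds φ ρ → Eval α (compileᶠ (neg φ)) ρ 0
        case-neg (yes h) _ = e-comp (accept (compileᶠ-ok φ ρ) h ∷ []) (e-isZero 1)
        case-neg (no ¬h) ¬¬h = contradiction ¬h ¬¬h
      compileᶠ-ok (some t φ) ρ = decides
        (λ (j , j<B , h) → e-comp
          (e-comp (found ∷ compile-ok t ρ ∷ []) (e-eq-no (<⇒≢ (proj₁ (least-holds P? B j<B h)))) ∷ [])
          (e-isZero 0))
        (λ ¬h → e-comp (e-comp (found ∷ compile-ok t ρ ∷ []) (e-eq-yes (none ¬h)) ∷ []) (e-isZero 1))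
        where
        P? = λ i → holds? φ (i ∷ ρ)
        B = ⟦ t ⟧ ρ
        found = e-comp (compile-ok t ρ ∷ e-ids) (e-search P? (λ i → compileᶠ-ok φ (i ∷ ρ)) B)
        none : ¬ (∃[ j ] j < B × Holds φ (j ∷ ρ)) → least P? B ≡ B
        none ¬h = least-unique P? B ≤-refl (λ B<B → contradiction B<B (<-irrefl refl))
          λ j j<B h → ¬h (j , j<B , h)
      compileᶠ-ok (callᶠ φ us) ρ = decides
        (λ h → e-comp (compile*-ok us ρ) (accept (compileᶠ-ok φ _) h))
        (λ ¬h → e-comp (compile*-ok us ρ) (reject (compileᶠ-ok φ _) ¬h))

-- Binary strings and pairs as numbers

-- `encode` is bijective base-two numeration, least significant digit first, with `false` as digit 1
-- and `true` as digit 2; this is its successor with carry. Iterating it inverts `encode`.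
increment : List Bool → List Bool
increment [] = false ∷ []
increment (false ∷ s) = true ∷ s
increment (true ∷ s) = false ∷ increment s

encode-increment : ∀ s → encode (increment s) ≡ suc (encode s)
encode-increment [] = refl
encode-increment (false ∷ s) = refl
encode-increment (true ∷ s) rewrite encode-increment s =
  solve 1 (λ e → con 1 :+ con 2 :* (con 1 :+ e) := con 3 :+ con 2 :* e) refl (encode s)

decode : ℕ → List Bool
decode zero = []
decode (suc n) = increment (decode n)

encode-decode : ∀ n → encode (decode n) ≡ n
encode-decode zero = refl
encode-decode (suc n) = trans (encode-increment (decode n)) (cong suc (encode-decode n))

encode-injective : ∀ s t → encode s ≡ encode t → s ≡ t
encode-injective [] [] _ = refl
encode-injective [] (false ∷ t) ()
encode-injective [] (true ∷ t) ()
encode-injective (false ∷ s) [] ()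
encode-injective (true ∷ s) [] ()
encode-injective (false ∷ s) (false ∷ t) eq =
  cong (false ∷_) (encode-injective s t (*-cancelˡ-≡ _ _ 2 (suc-injective eq)))
encode-injective (true ∷ s) (true ∷ t) eq =
  cong (true ∷_) (encode-injective s t (*-cancelˡ-≡ _ _ 2 (suc-injective (suc-injective eq))))
encode-injective (false ∷ s) (true ∷ t) eq =
  contradiction (suc-injective eq) (even≢odd (encode s) (encode t))
encode-injective (true ∷ s) (false ∷ t) eq =
  contradiction (sym (suc-injective eq)) (even≢odd (encode t) (encode s))

decode-encode : ∀ s → decode (encode s) ≡ s
decode-encode s = encode-injective _ s (encode-decode (encode s))

-- Each leading bit doubles what follows it. Appending and the prefix relation thereby become
-- arithmetic, within reach of the term language.
encode-++ : ∀ s r → encode (s ++ r) ≡ encode s + 2 ^ length s * encode r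
encode-++ [] r = sym (+-identityʳ (encode r))
encode-++ (false ∷ s) r rewrite encode-++ s r =
  solve 3 (λ a p b → con 1 :+ con 2 :* (a :+ p :* b) := con 1 :+ con 2 :* a :+ (con 2 :* p) :* b)
    refl (encode s) (2 ^ length s) (encode r)
encode-++ (true ∷ s) r rewrite encode-++ s r =
  solve 3 (λ a p b → con 2 :+ con 2 :* (a :+ p :* b) := con 2 :+ con 2 :* a :+ (con 2 :* p) :* b)
    refl (encode s) (2 ^ length s) (encode r)

-- The all-`true` string has the largest code of its length, `2 * 2 ^ length s - 2`, and only there
-- does the carry create a new digit.
length-increment : ∀ s →
  (encode s + 2 ≡ 2 * 2 ^ length s × length (increment s) ≡ suc (length s)) ⊎
  (encode s + 2 < 2 * 2 ^ length s × length (increment s) ≡ length s)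
length-increment [] = inj₁ (refl , refl)
length-increment (false ∷ s) = inj₂ (lt , refl)
  where
  bound : encode s + 2 ≤ 2 * 2 ^ length s
  bound with length-increment s
  ... | inj₁ (eq , _) = ≤-reflexive eq
  ... | inj₂ (lt , _) = <⇒≤ lt
  lt : suc (1 + 2 * encode s + 2) ≤ 2 * (2 * 2 ^ length s)
  lt = subst (_≤ 2 * (2 * 2 ^ length s))
    (solve 1 (λ e → con 2 :* (e :+ con 2) := con 2 :+ con 2 :* e :+ con 2) refl (encode s))
    (*-monoʳ-≤ 2 bound)
length-increment (true ∷ s) with length-increment s
... | inj₁ (eq , leq) = inj₁ (trans (double (encode s)) (cong (2 *_) eq) , cong suc leq)
  where
  double : ∀ e → 2 + 2 * e + 2 ≡ 2 * (e + 2)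
  double = solve 1 (λ e → con 2 :+ con 2 :* e :+ con 2 := con 2 :* (e :+ con 2)) refl
... | inj₂ (lt , leq) = inj₂ (subst (_< 2 * (2 * 2 ^ length s)) (double (encode s)) (*-monoʳ-< 2 lt) , cong suc leq)
  where
  double : ∀ e → 2 * (e + 2) ≡ 2 + 2 * e + 2
  double = solve 1 (λ e → con 2 :* (e :+ con 2) := con 2 :+ con 2 :* e :+ con 2) refl

⪯-refl : ∀ {s} → s ⪯ s
⪯-refl = [] , ++-identityʳ _

⪯-trans : ∀ {s t u} → s ⪯ t → t ⪯ u → s ⪯ u
⪯-trans {s} (r , refl) (r′ , refl) = r ++ r′ , sym (++-assoc s r r′)

⪯⇒encode≤ : ∀ {s t} → s ⪯ t → encode s ≤ encode t
⪯⇒encode≤ {s} (r , refl) = subst (encode s ≤_) (sym (encode-++ s r)) (m≤m+n _ _)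

_≼_ : ℕ → ℕ → Set
a ≼ b = decode a ⪯ decode b

≼⇒≤ : ∀ a b → a ≼ b → a ≤ b
≼⇒≤ a b a≼b = subst₂ _≤_ (encode-decode a) (encode-decode b) (⪯⇒encode≤ a≼b)

opaque
  -- Counts up to the argument, doubling exactly at the codes where incrementing lengthens the
  -- decoded string.
  powerᵗ : Tm 1
  powerᵗ = rec (lit 1) (ite (v0 ⊞ lit 2 ≐ lit 2 ⊠ v1) (lit 2 ⊠ v1) v1) v0

  -- The quantified number codes the string to be appended. It never exceeds the code of the whole,
  -- hence the bound.
  prefixᶠ : Fm 2
  prefixᶠ = some (lit 1 ⊞ v1) (v2 ≐ v1 ⊞ call powerᵗ (v1 ∷ []) ⊠ v0)

module _ (x : ℕ → ℕ) where
  open Semantics x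

  opaque
    unfolding powerᵗ

    power-correct : ∀ n → ⟦ powerᵗ ⟧ (n ∷ []) ≡ 2 ^ length (decode n)
    power-correct zero = refl
    power-correct (suc n) = trans (cong f (power-correct n)) body
      where
      f : ℕ → ℕ
      f r = choose (n + 2 ≟ 2 * r) (2 * r) r
      body : f (2 ^ length (decode n)) ≡ 2 ^ length (increment (decode n))
      body with length-increment (decode n)
      ... | inj₁ (eq , leq) rewrite leq =
        choose-yes (n + 2 ≟ _) (subst (λ m → m + 2 ≡ 2 * 2 ^ length (decode n)) (encode-decode n) eq)
      ... | inj₂ (lt , leq) rewrite leq =
        choose-no (n + 2 ≟ _) (<⇒≢ (subst (λ m → m + 2 < 2 * 2 ^ length (decode n)) (encode-decode n) lt))

  append : ∀ n r → n + ⟦ powerᵗ ⟧ (n ∷ []) * encode r ≡ encode (decode n ++ r)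
  append n r rewrite power-correct n =
    sym (trans (encode-++ (decode n) r) (cong (_+ 2 ^ length (decode n) * encode r) (encode-decode n)))

  opaque
    unfolding prefixᶠ

    prefix-sound : ∀ a b → Holds prefixᶠ (a ∷ b ∷ []) → a ≼ b
    prefix-sound a b (q , _ , eq) = decode q , encode-injective _ _ (begin
      encode (decode a ++ decode q)                          ≡⟨ append a (decode q) ⟨
      a + ⟦ powerᵗ ⟧ (a ∷ []) * encode (decode q)            ≡⟨ cong (λ m → a + ⟦ powerᵗ ⟧ (a ∷ []) * m) (encode-decode q) ⟩
      a + ⟦ powerᵗ ⟧ (a ∷ []) * q                            ≡⟨ eq ⟨
      b                                                      ≡⟨ encode-decode b ⟨
      encode (decode b)                                      ∎)
      where open ≡-Reasoning

    prefix-complete : ∀ a b → a ≼ b → Holds prefixᶠ (a ∷ b ∷ [])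
    prefix-complete a b (r , eq) = encode r , s≤s bound , b≡
      where
      b≡ : b ≡ a + ⟦ powerᵗ ⟧ (a ∷ []) * encode r
      b≡ = trans (trans (sym (encode-decode b)) (cong encode (sym eq))) (sym (append a r))
      bound : encode r ≤ b
      bound = begin
        encode r                              ≤⟨ m≤n*m (encode r) (2 ^ length (decode a)) {{m^n≢0 2 (length (decode a))}} ⟩
        2 ^ length (decode a) * encode r      ≡⟨ cong (_* encode r) (power-correct a) ⟨
        ⟦ powerᵗ ⟧ (a ∷ []) * encode r        ≤⟨ m≤n+m _ a ⟩
        a + ⟦ powerᵗ ⟧ (a ∷ []) * encode r    ≡⟨ b≡ ⟨
        b                                     ∎
        where open ≤-Reasoning

tri-mono : ∀ {m n} → m ≤ n → tri m ≤ tri n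
tri-mono z≤n = z≤n
tri-mono (s≤s m≤n) = +-mono-≤ (s≤s m≤n) (tri-mono m≤n)

n≤tri : ∀ n → n ≤ tri n
n≤tri zero = z≤n
n≤tri (suc n) = m≤m+n (suc n) (tri n)

-- Even the last entry of a diagonal, `tri n + n`, falls short of `tri (suc n)`, where the next
-- diagonal starts.
pair-< : ∀ {a b a′ b′} → a + b < a′ + b′ → pair a b < pair a′ b′
pair-< {a} {b} {a′} {b′} lt = begin-strict
  tri (a + b) + b                ≡⟨ +-comm (tri (a + b)) b ⟩
  b + tri (a + b)                <⟨ s≤s (+-monoˡ-≤ (tri (a + b)) (m≤n+m b a)) ⟩
  tri (suc (a + b))              ≤⟨ tri-mono lt ⟩
  tri (a′ + b′)                  ≤⟨ m≤m+n _ b′ ⟩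
  tri (a′ + b′) + b′             ∎
  where open ≤-Reasoning

pair-injective : ∀ {a b a′ b′} → pair a b ≡ pair a′ b′ → a ≡ a′ × b ≡ b′
pair-injective {a} {b} {a′} {b′} eq = +-cancelʳ-≡ b a a′ (trans sum-eq (cong (a′ +_) (sym b≡))) , b≡
  where
  sum-eq : a + b ≡ a′ + b′
  sum-eq = ≤-antisym (≮⇒≥ λ lt → <-irrefl (sym eq) (pair-< {a′} {b′} {a} {b} lt))
                     (≮⇒≥ λ lt → <-irrefl eq (pair-< {a} {b} {a′} {b′} lt))
  b≡ : b ≡ b′
  b≡ = +-cancelˡ-≡ (tri (a + b)) b b′ (trans eq (cong (λ s → tri s + b′) (sym sum-eq)))

≤-pairˡ : ∀ a b → a ≤ pair a b
≤-pairˡ a b = ≤-trans (≤-trans (m≤m+n a b) (n≤tri (a + b))) (m≤m+n _ b)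

≤-pairʳ : ∀ a b → b ≤ pair a b
≤-pairʳ a b = m≤n+m b (tri (a + b))

-- The converging tower of nodes

-- Arguments: seenᶠ (c, τ, s), diversityᵗ (τ, s), candidateᶠ (p, i, T_i(s), s),
-- towerᵗ (i, s), changesᶠ (i, a, y), levelᵗ (pair a y).
seenᶠ : Fm 3
seenᶠ = some (lit 1 ⊞ v2) (callᶠ prefixᶠ (v2 ∷ v0 ∷ []) ∧ ask v0 ≐ v1)

opaque
  diversityᵗ : ℕ → Tm 2
  diversityᵗ k = number (lit k) seenᶠ

candidateᶠ : ℕ → Fm 4
candidateᶠ k = callᶠ prefixᶠ (v2 ∷ v0 ∷ []) ∧
  some (lit k) (call (diversityᵗ k) (v1 ∷ v4 ∷ []) ⊞ v2 ≐ v0)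

opaque
  towerᵗ : ℕ → Tm 2
  towerᵗ k = rec (lit 0)
    (search (v1 ⊞ call powerᵗ (v1 ∷ []) ⊠ (lit 1 ⊞ v3))
      (callᶠ (candidateᶠ k) (v0 ∷ v1 ∷ v2 ∷ v4 ∷ [])))
    v0

opaque
  changesᶠ : ℕ → Fm 3
  changesᶠ k = some (lit 1 ⊞ v2)
    (neg (call (towerᵗ k) (lit 1 ⊞ v1 ∷ v2 ⊞ v0 ∷ []) ≐ call (towerᵗ k) (lit 1 ⊞ v1 ∷ v2 ∷ [])))

opaque
  triᵗ : Tm 1
  triᵗ = rec (lit 0) (lit 1 ⊞ v0 ⊞ v1) v0

opaque
  levelᵗ : ℕ → Tm 1
  levelᵗ k = search (lit k)
    (some (lit 1 ⊞ v1) (some (lit 1 ⊞ v2)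
      (call triᵗ (v1 ⊞ v0 ∷ []) ⊞ v0 ≐ v3 ∧ callᶠ (changesᶠ (suc k)) (v2 ∷ v1 ∷ v0 ∷ []))))

module Tower (x : ℕ → ℕ) (k : ℕ) where
  open Semantics x

  Seen : ℕ → ℕ → ℕ → Set
  Seen τ s c = ∃[ ρ ] ρ < suc s × τ ≼ ρ × x ρ ≡ c

  seen-later : ∀ {τ s s′} → s ≤ s′ → ∀ c → Seen τ s c → Seen τ s′ c
  seen-later s≤s′ c (ρ , lt , r) = ρ , ≤-trans lt (s≤s s≤s′) , r

  seen-below : ∀ {τ τ′ s} → τ ≼ τ′ → ∀ c → Seen τ′ s c → Seen τ s c
  seen-below {τ} {τ′} τ≼τ′ c (ρ , lt , τ′≼ρ , eq) =
    ρ , lt , ⪯-trans {decode τ} {decode τ′} {decode ρ} τ≼τ′ τ′≼ρ , eq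

  unseen-above : ∀ {τ s} → s < τ → ∀ c → ¬ Seen τ s c
  unseen-above {τ} s<τ c (ρ , s≤s ρ≤s , τ≼ρ , _) =
    <-irrefl refl (<-≤-trans s<τ (≤-trans (≼⇒≤ τ ρ τ≼ρ) ρ≤s))

  D : ℕ → ℕ → ℕ
  D τ s = ⟦ diversityᵗ k ⟧ (τ ∷ s ∷ [])

  T : ℕ → ℕ → ℕ
  T i s = ⟦ towerᵗ k ⟧ (i ∷ s ∷ [])

  seen-sound : ∀ τ s c → Holds seenᶠ (c ∷ τ ∷ s ∷ []) → Seen τ s c
  seen-sound τ s c (ρ , lt , pre , eq) = ρ , lt , prefix-sound x τ ρ pre , eq

  seen-complete : ∀ τ s c → Seen τ s c → Holds seenᶠ (c ∷ τ ∷ s ∷ [])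
  seen-complete τ s c (ρ , lt , pre , eq) = ρ , lt , prefix-complete x τ ρ pre , eq

  seen? : ∀ τ s → Decidable (λ c → Holds seenᶠ (c ∷ τ ∷ s ∷ []))
  seen? τ s c = holds? seenᶠ (c ∷ τ ∷ s ∷ [])

  opaque
    unfolding diversityᵗ

    D≤k : ∀ τ s → D τ s ≤ k
    D≤k τ s = count≤ (seen? τ s) k

    D-mono : ∀ {τ s τ′ s′} → (∀ c → Seen τ s c → Seen τ′ s′ c) → D τ s ≤ D τ′ s′
    D-mono {τ} {s} {τ′} {s′} sub = count-mono (seen? τ s) (seen? τ′ s′)
      (λ c h → seen-complete τ′ s′ c (sub c (seen-sound τ s c h))) k

    D-strict : ∀ {τ s τ′ s′ c} → (∀ c → Seen τ s c → Seen τ′ s′ c) →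
      c < k → ¬ Seen τ s c → Seen τ′ s′ c → D τ s < D τ′ s′
    D-strict {τ} {s} {τ′} {s′} {c} sub c<k unseen seen = count-strict (seen? τ s) (seen? τ′ s′)
      (λ c h → seen-complete τ′ s′ c (sub c (seen-sound τ s c h))) k c<k
      (λ h → unseen (seen-sound τ s c h)) (seen-complete τ′ s′ c seen)

    D-unseen : ∀ {τ s} → s < τ → D τ s ≡ 0
    D-unseen {τ} {s} s<τ = count-none (seen? τ s) k
      λ c h → unseen-above s<τ c (seen-sound τ s c h)

  -- The inequality bounds the number of colours seen by `k - (i + 1)`, written without truncated
  -- subtraction.
  Candidate : ℕ → ℕ → ℕ → Set
  Candidate i s p = T i s ≼ p × D p s + i < k

  candidate-env : ℕ → ℕ → ℕ → Vec ℕ 4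
  candidate-env i s p = p ∷ i ∷ T i s ∷ s ∷ []

  candidate? : ∀ i s → Decidable (λ p → Holds (candidateᶠ k) (candidate-env i s p))
  candidate? i s p = holds? (candidateᶠ k) (candidate-env i s p)

  candidate-sound : ∀ i s p → Holds (candidateᶠ k) (candidate-env i s p) → Candidate i s p
  candidate-sound i s p (pre , e , e<k , eq) =
    prefix-sound x (T i s) p pre , subst (_< k) (sym eq) e<k

  candidate-complete : ∀ i s p → Candidate i s p → Holds (candidateᶠ k) (candidate-env i s p)
  candidate-complete i s p (pre , lt) = prefix-complete x (T i s) p pre , _ , lt , refl

  -- The code of `T i s` followed by the string with code `suc s`. It exceeds `s`, so nothing has
  -- been seen above it by stage `s`; for `i < k` it is itself a candidate, and a search that runs
  -- into it still returns a candidate.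
  bound : ℕ → ℕ → ℕ
  bound i s = T i s + ⟦ powerᵗ ⟧ (T i s ∷ []) * suc s

  bound≡ : ∀ i s → bound i s ≡ encode (decode (T i s) ++ decode (suc s))
  bound≡ i s = trans
    (cong (λ m → T i s + ⟦ powerᵗ ⟧ (T i s ∷ []) * m) (sym (encode-decode (suc s))))
    (append x (T i s) (decode (suc s)))

  bound-candidate : ∀ i s → i < k → Candidate i s (bound i s)
  bound-candidate i s i<k =
    (decode (suc s) , sym (trans (cong decode (bound≡ i s)) (decode-encode _))) ,
    subst (λ d → d + i < k) (sym (D-unseen s<bound)) i<k
    where
    power = 2 ^ length (decode (T i s))
    s<bound : s < bound i s
    s<bound = ≤-trans (m≤n*m (suc s) power {{m^n≢0 2 (length (decode (T i s)))}})
      (≤-trans (≤-reflexive (cong (_* suc s) (sym (power-correct x (T i s))))) (m≤n+m _ (T i s)))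

  opaque
    unfolding towerᵗ

    T-zero : ∀ s → T 0 s ≡ 0
    T-zero s = refl

    T-suc : ∀ i s → T (suc i) s ≡ least (candidate? i s) (bound i s)
    T-suc i s = refl

  T-candidate : ∀ {i s} → i < k → Candidate i s (T (suc i) s)
  T-candidate {i} {s} i<k with least-spec (candidate? i s) (bound i s)
  ... | _ , inj₁ (_ , h) = subst (Candidate i s) (sym (T-suc i s)) (candidate-sound i s _ h)
  ... | _ , inj₂ eq = subst (Candidate i s) (sym (trans (T-suc i s) eq)) (bound-candidate i s i<k)

  T-least : ∀ {i s p} → Candidate i s p → T (suc i) s ≤ p
  T-least {i} {s} {p} c = subst (_≤ p) (sym (T-suc i s))
    (least-minimal (candidate? i s) (bound i s) (candidate-complete i s p c))

  T-≼ : ∀ i s d → d + i ≤ k → T i s ≼ T (d + i) s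
  T-≼ i s zero _ = ⪯-refl
  T-≼ i s (suc d) d<k = ⪯-trans {decode (T i s)} {decode (T (d + i) s)}
    (T-≼ i s d (<⇒≤ d<k)) (proj₁ (T-candidate d<k))

  D+i≤k : ∀ {i s} → i ≤ k → D (T i s) s + i ≤ k
  D+i≤k {zero} {s} _ = subst (_≤ k) (sym (+-identityʳ _)) (D≤k (T 0 s) s)
  D+i≤k {suc i} {s} i<k = subst (_≤ k) (sym (+-suc (D (T (suc i) s) s) i)) (proj₂ (T-candidate i<k))

-- Convergence of the levels and density of colours

module Stability (em : ExcludedMiddle 0ℓ) (x : ℕ → ℕ) (k : ℕ) (x<k : ∀ n → x n < k) where
  open Tower x k public

  Stable : ℕ → Set
  Stable i = ∃[ N ] ∀ s → N ≤ s → T i s ≡ T i N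

  by-contradiction : {P : Set} → ¬ ¬ P → P
  by-contradiction = decidable-stable em

  -- Induction on the gap `g` left below the bound: either `u` never exceeds `u N` again, or the
  -- argument restarts at a later stage with a smaller gap. Excluded middle picks the case.
  monotone-converges : ∀ (u : ℕ → ℕ) b g N → (∀ s → N ≤ s → u s ≤ u (suc s)) →
    (∀ s → N ≤ s → u s ≤ b) → b ≤ u N + g → ∃[ M ] ∀ s → M ≤ s → u s ≡ u M
  monotone-converges u b g N incr bounded gap with em {∃[ s ] N ≤ s × u N < u s}
  ... | no ¬jump = N , λ s N≤s → ≤-antisym (≮⇒≥ λ lt → ¬jump (s , N≤s , lt)) (from-N N≤s)
    where
    from-N : ∀ {s} → N ≤ s → u N ≤ u s
    from-N {s} N≤s with m≤n⇒m<n∨m≡n N≤s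
    from-N {suc s} _ | inj₁ (s≤s N≤s) = ≤-trans (from-N N≤s) (incr s N≤s)
    ... | inj₂ refl = ≤-refl
  monotone-converges u b zero N incr bounded gap | yes (s , N≤s , lt) =
    contradiction (≤-trans (≤-trans lt (bounded s N≤s)) gap)
                  (≤⇒≯ (≤-reflexive (+-identityʳ (u N))))
  monotone-converges u b (suc g) N incr bounded gap | yes (s , N≤s , lt) =
    monotone-converges u b g s (λ r s≤r → incr r (≤-trans N≤s s≤r))
      (λ r s≤r → bounded r (≤-trans N≤s s≤r))
      (≤-trans gap (≤-trans (≤-reflexive (+-suc (u N) g)) (+-monoˡ-≤ g lt)))

  -- While `T i` is fixed, seen colours only accumulate, so a candidate at a later stage was already
  -- one before, and the least candidate never decreases. The permanent candidate `τ` bounds it.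
  stable-suc : ∀ {i σ τ} N → i < k → (∀ s → N ≤ s → T i s ≡ σ) →
    (∀ s → N ≤ s → Candidate i s τ) → Stable (suc i)
  stable-suc {i} {σ} {τ} N i<k T≡σ cand =
    monotone-converges (T (suc i)) τ τ N
      (λ s N≤s → T-least {i} {s} (back s N≤s (T-candidate {i} {suc s} i<k)))
      (λ s N≤s → T-least {i} {s} (cand s N≤s)) (m≤n+m τ _)
    where
    back : ∀ s {p} → N ≤ s → Candidate i (suc s) p → Candidate i s p
    back s {p} N≤s (pre , lt) =
      subst (_≼ p) (trans (T≡σ (suc s) (m≤n⇒m≤1+n N≤s)) (sym (T≡σ s N≤s))) pre ,
      ≤-<-trans (+-monoˡ-≤ i (D-mono {p} {s} {p} {suc s} (seen-later {p} (n≤1+n s)))) lt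

  StableUpTo : ℕ → ℕ → Set
  StableUpTo i N = ∀ j → j ≤ i → ∀ s → N ≤ s → T j s ≡ T j N

  -- Starting from the constant root, levels are added as long as they converge; the maximum of the
  -- stages found serves all of them at once.
  last-stable : ∀ m → ∃[ i ] i ≤ m × (∃[ N ] StableUpTo i N) × (i ≡ m ⊎ (i < m × ¬ Stable (suc i)))
  last-stable zero = 0 , z≤n , (0 , λ { .0 z≤n s _ → trans (T-zero s) (sym (T-zero 0)) }) , inj₁ refl
  last-stable (suc m) with last-stable m
  ... | i , i≤m , st , inj₂ (i<m , unst) = i , m≤n⇒m≤1+n i≤m , st , inj₂ (m≤n⇒m≤1+n i<m , unst)
  ... | .m , _ , (N , st) , inj₁ refl with em {Stable (suc m)}
  ...   | no unst = m , n≤1+n m , (N , st) , inj₂ (≤-refl , unst)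
  ...   | yes (N′ , eq) = suc m , ≤-refl , (N ⊔ N′ , st′) , inj₁ refl
    where
    settle : ∀ {j M} → M ≤ N ⊔ N′ → (∀ s → M ≤ s → T j s ≡ T j M) →
      ∀ s → N ⊔ N′ ≤ s → T j s ≡ T j (N ⊔ N′)
    settle M≤ h s le = trans (h s (≤-trans M≤ le)) (sym (h _ M≤))
    st′ : StableUpTo (suc m) (N ⊔ N′)
    st′ j j≤ with m≤n⇒m<n∨m≡n j≤
    ... | inj₁ (s≤s j≤m) = settle (m≤m⊔n N N′) (st j j≤m)
    ... | inj₂ refl = settle (m≤n⊔m N N′) eq

  -- If some colour of the stable node T i m were missing above τ, then τ would be a candidate for
  -- the next level forever, so that level would stabilise as well.
  dense : ∀ {i m t τ} → i < k → (∀ s → m ≤ s → T i s ≡ T i m) →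
    (suc i ≡ k ⊎ ¬ Stable (suc i)) → T i m ≼ t → T i m ≼ τ → ∃[ ρ ] τ ≼ ρ × x ρ ≡ x t
  dense {i} {m} {t} {τ} i<k stable last σ≼t σ≼τ = by-contradiction λ missing →
    let
      unseen : ∀ s → ¬ Seen τ s (x t)
      unseen s (ρ , _ , τ≼ρ , eq) = missing (ρ , τ≼ρ , eq)
      -- From stage `m ⊔ t` on, `t` has been seen above `T i s`, so its colour is counted there but
      -- never above `τ`. This strict drop is what the next level asks of a candidate.
      small : ∀ s → m ⊔ t ≤ s → D τ s + i < k
      small s le = <-≤-trans
        (+-monoˡ-< i (D-strict {τ} {s} {T i s} {s} (seen-below {T i s} {τ} (σ≼ s {τ} le σ≼τ)) (x<k t) (unseen s)
          (t , s≤s (≤-trans (m≤n⊔m m t) le) , σ≼ s {t} le σ≼t , refl)))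
        (D+i≤k {i} {s} (<⇒≤ i<k))
    in finish last small
    where
    σ≼ : ∀ s {p} → m ⊔ t ≤ s → T i m ≼ p → T i s ≼ p
    σ≼ s {p} le = subst (_≼ p) (sym (stable s (≤-trans (m≤m⊔n m t) le)))
    finish : (suc i ≡ k ⊎ ¬ Stable (suc i)) → ¬ (∀ s → m ⊔ t ≤ s → D τ s + i < k)
    finish (inj₂ unst) small = unst (stable-suc (m ⊔ t) i<k
      (λ s le → stable s (≤-trans (m≤m⊔n m t) le)) λ s le → σ≼ s {τ} le σ≼τ , small s le)
    -- At the last level `small` forces `D τ s` to be 0, although `τ` itself has been seen by stage
    -- `m ⊔ t ⊔ τ`.
    finish (inj₁ refl) small = <-irrefl refl
      (<-≤-trans pos (m<1+n⇒m≤n (+-cancelʳ-≤ i (suc (D τ s)) 1 (small s (m≤m⊔n _ τ)))))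
      where
      s = m ⊔ t ⊔ τ
      pos : 0 < D τ s
      -- The node `suc s`, above which nothing is seen by stage `s`, supplies the count 0 for
      -- comparison.
      pos = subst (_< D τ s) (D-unseen (≤-refl {suc s}))
        (D-strict {suc s} {s} {τ} {s} (λ c seen → contradiction seen (unseen-above ≤-refl c))
          (x<k τ) (unseen-above ≤-refl (x τ))
          (τ , s≤s (m≤n⊔m (m ⊔ t) τ) , ⪯-refl , refl))

-- The limit colouring and its homogeneous sets

module Levels (em : ExcludedMiddle 0ℓ) (x : ℕ → ℕ) (k : ℕ) (x≤k : ∀ n → x n < suc k) where
  open Semantics x
  open Stability em x (suc k) x≤k public

  Changes : ℕ → ℕ → ℕ → Set
  Changes i a y = ∃[ s ] s < suc y × T (suc i) (a + s) ≢ T (suc i) a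

  opaque
    unfolding triᵗ

    tri-correct : ∀ n → ⟦ triᵗ ⟧ (n ∷ []) ≡ tri n
    tri-correct zero = refl
    tri-correct (suc n) = cong (suc n +_) (tri-correct n)

  level : ℕ → ℕ
  level n = ⟦ levelᵗ k ⟧ (n ∷ [])

  opaque
    unfolding levelᵗ changesᶠ

    level≤k : ∀ n → level n ≤ k
    level≤k n = least-≤ _ k

    -- `levelᵗ` recovers `a` and `y` by searching below their code; injectivity of pairing ensures
    -- that no other pair can make a smaller index pass.
    level-pair : ∀ a y v → v ≤ k → (v < k → Changes v a y) → (∀ j → j < v → ¬ Changes j a y) →
      level (pair a y) ≡ v
    level-pair a y v v≤k changes below = least-unique _ k v≤k
      (λ v<k → a , s≤s (≤-pairˡ a y) , y , s≤s (≤-pairʳ a y) ,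
        cong (_+ y) (tri-correct (a + y)) , changes v<k)
      λ { j j<v (a′ , _ , y′ , _ , eq , ch) → below j j<v
            (move j (pair-injective {a′} {y′} {a} {y} (trans (cong (_+ y′) (sym (tri-correct (a′ + y′)))) eq)) ch) }
      where
      move : ∀ j {a′ y′} → a′ ≡ a × y′ ≡ y → Changes j a′ y′ → Changes j a y
      move j (refl , refl) ch = ch

  Moves : ℕ → ℕ → Set
  Moves i a = ∃[ s ] T (suc i) (a + s) ≢ T (suc i) a

  fixed : ∀ {i a} → ¬ Moves i a → ∀ s → a ≤ s → T (suc i) s ≡ T (suc i) a
  fixed {i} {a} still s a≤s = subst (λ r → T (suc i) r ≡ T (suc i) a) (m+[n∸m]≡n a≤s)
    (decidable-stable (_ ≟ _) λ neq → still (s ∸ a , neq))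

  -- No index below `v` ever moves, so the least index caught moving is `v` as soon as `y` reaches a
  -- witness of its move; for `v` equal to `k` there is nothing to wait for.
  limit-is : ∀ a v → v ≤ k → (v < k → Moves v a) → (∀ j → j < v → ¬ Moves j a) → LimIs level a v
  limit-is a v v≤k moves below with m≤n⇒m<n∨m≡n v≤k
  ... | inj₁ v<k = let (s , neq) = moves v<k in
    s , λ y s≤y → level-pair a y v v≤k (λ _ → s , s≤s s≤y , neq) λ j j<v (r , _ , ne) → below j j<v (r , ne)
  ... | inj₂ refl = 0 , λ y _ → level-pair a y v v≤k (λ v<v → contradiction v<v (<-irrefl refl))
    λ j j<v (r , _ , ne) → below j j<v (r , ne)

  limit-unique : ∀ {z a c c′} → LimIs z a c → LimIs z a c′ → c ≡ c′
  limit-unique (N , eq) (N′ , eq′) = trans (sym (eq (N ⊔ N′) (m≤m⊔n N N′))) (eq′ (N ⊔ N′) (m≤n⊔m N N′))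

  limit : ∀ a → ∃[ v ] (∀ j → j < v → ¬ Moves j a) × LimIs level a v
  limit a with least-spec (λ i → em {Moves i a}) k
  ... | below , inj₁ (lt , moves) = _ , below , limit-is a _ (<⇒≤ lt) (λ _ → moves) below
  ... | below , inj₂ eq = _ , below ,
    limit-is a _ (≤-reflexive eq) (λ lt → contradiction lt (<-irrefl eq)) below

  -- Far out in M every level below the first unstable one has settled, so the limit colour there is
  -- that level; homogeneity transfers this to the small elements of M.
  homogeneous-level : ∀ {M} → D2Solution (suc k) level M → ∃[ i ] i < suc k ×
    (suc i ≡ suc k ⊎ ¬ Stable (suc i)) × (∀ m → m ∈ˢ M → ∀ s → m ≤ s → T i s ≡ T i m)
  homogeneous-level {M} (_ , infinite , c , limits) with last-stable k
  ... | i , i≤k , (N , st) , last with infinite N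
  ... | a , N<a , a∈M = i , s≤s i≤k , unstable last , settled
    where
    unstable : i ≡ k ⊎ (i < k × ¬ Stable (suc i)) → suc i ≡ suc k ⊎ ¬ Stable (suc i)
    unstable (inj₁ eq) = inj₁ (cong suc eq)
    unstable (inj₂ (_ , unst)) = inj₂ unst
    moves : i ≡ k ⊎ (i < k × ¬ Stable (suc i)) → i < k → Moves i a
    moves (inj₁ refl) i<i = contradiction i<i (<-irrefl refl)
    moves (inj₂ (_ , unst)) _ = by-contradiction λ still → unst (a , fixed still)
    N≤a = <⇒≤ N<a
    still-below : ∀ j → j < i → ¬ Moves j a
    still-below j j<i (s , neq) =
      neq (trans (st (suc j) j<i (a + s) (≤-trans N≤a (m≤m+n a s))) (sym (st (suc j) j<i a N≤a)))
    c≡i : c ≡ i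
    c≡i = limit-unique {level} {a} (limits a a∈M) (limit-is a i i≤k (moves last) still-below)
    settled-at : ∀ j → j ≡ i → ∀ m → m ∈ˢ M → ∀ s → m ≤ s → T j s ≡ T j m
    settled-at zero _ m _ s _ = trans (T-zero s) (sym (T-zero m))
    -- The limit colour of `m` is `suc j`, so index `j` does not move after `m`, and index `j` is
    -- the one that governs `T (suc j)`.
    settled-at (suc j) j≡i m m∈M with limit m
    ... | v , below , lim = fixed (below j (subst (j <_)
      (trans j≡i (trans (sym c≡i) (limit-unique {level} {m} (limits m m∈M) lim))) ≤-refl))
    settled : ∀ m → m ∈ˢ M → ∀ s → m ≤ s → T i s ≡ T i m
    settled = settled-at i refl

  level-instance : D2Instance (suc k) level
  level-instance = (λ n → s≤s (level≤k n)) , λ a → let (v , _ , lim) = limit a in v , lim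

  -- The index `i` is unknown to the reduction, but above `T i m` the colour of every node is dense,
  -- in particular that of the computable node `T k m`.
  top-dense : ∀ {M m} → D2Solution (suc k) level M → m ∈ˢ M → ∀ {τ} → T k m ≼ τ →
    ∃[ ρ ] τ ≼ ρ × x ρ ≡ x (T k m)
  top-dense {M} {m} sol m∈M {τ} t≼τ with homogeneous-level {M} sol
  ... | i , s≤s i≤k , last , settled = dense {i} {m} {T k m} {τ} (s≤s i≤k) (settled m m∈M) last σ≼t
    (⪯-trans {decode (T i m)} {decode (T k m)} σ≼t t≼τ)
    where
    σ≼t : T i m ≼ T k m
    σ≼t = subst (λ j → T i m ≼ T j m) (m∸n+n≡m i≤k)
      (T-≼ i m (k ∸ i) (≤-trans (≤-reflexive (m∸n+n≡m i≤k)) (n≤1+n k)))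

-- Growing the monochromatic tree

-- Arguments: extendsᶠ and nextᶠ (ρ, ν, encode (b ∷ []), t), advanceᶠ (ρ′, ν, ρ, t), advanceᵗ (ν, ρ, t),
-- walkᵗ (l, ρ, t), memberᵗ (ρ, t).  The one-bit strings have codes 1 and 2.
extendsᶠ : Fm 4
extendsᶠ = callᶠ prefixᶠ (v1 ⊞ call powerᵗ (v1 ∷ []) ⊠ v2 ∷ v0 ∷ []) ∧ ask v0 ≐ ask v3

opaque
  nextᶠ : Fm 4
  nextᶠ = extendsᶠ ∧ neg (some v0 (callᶠ extendsᶠ (v0 ∷ v2 ∷ v3 ∷ v4 ∷ [])))

opaque
  advanceᶠ : Fm 4
  advanceᶠ = callᶠ prefixᶠ (v0 ∷ v2 ∷ []) ∧
    some (lit 2) (callᶠ nextᶠ (v1 ∷ v2 ∷ lit 1 ⊞ v0 ∷ v4 ∷ []))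

advanceᵗ : Tm 3
advanceᵗ = ite (some (lit 1 ⊞ v1) φ) (search (lit 1 ⊞ v1) φ) v0
  where
  φ : Fm 4
  φ = callᶠ advanceᶠ (v0 ∷ v1 ∷ v2 ∷ v3 ∷ [])

opaque
  walkᵗ : Tm 3
  walkᵗ = rec v2 (call advanceᵗ (v1 ∷ v3 ∷ v4 ∷ [])) v0

opaque
  memberᵗ : Tm 2
  memberᵗ = ite (some (lit 1 ⊞ v0) (call walkᵗ (v0 ∷ v1 ∷ v2 ∷ []) ≐ v1)) (lit 1) (lit 0)

-- Correctness of the monochromatic tree

module Subtree (em : ExcludedMiddle 0ℓ) (x : ℕ → ℕ) (t : ℕ)
               (dense : ∀ {τ} → t ≼ τ → ∃[ ρ ] τ ≼ ρ × x ρ ≡ x t) where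
  open Semantics x

  Extends : ℕ → Bool → ℕ → Set
  Extends ν b ρ = (decode ν ++ b ∷ []) ⪯ decode ρ × x ρ ≡ x t

  Next : ℕ → Bool → ℕ → Set
  Next ν b ρ = Extends ν b ρ × (∀ ρ′ → ρ′ < ρ → ¬ Extends ν b ρ′)

  decode-append : ∀ ν s → decode (ν + ⟦ powerᵗ ⟧ (ν ∷ []) * encode s) ≡ decode ν ++ s
  decode-append ν s = trans (cong decode (append x ν s)) (decode-encode _)

  next-unique : ∀ {ν b ρ ρ′} → Next ν b ρ → Next ν b ρ′ → ρ ≡ ρ′
  next-unique (e , l) (e′ , l′) = ≤-antisym (≮⇒≥ λ lt → l _ lt e′) (≮⇒≥ λ lt → l′ _ lt e)

  child : ℕ → Bool → ℕ
  child ν b = encode (decode ν ++ b ∷ [])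

  -- With the child as default, `next ν b` lies above the child in every case, so the order facts
  -- about `climb` hold from any node; colour and leastness are what `t ≼ ν` adds.
  next : ℕ → Bool → ℕ
  next ν b with em {∃[ ρ ] Next ν b ρ}
  ... | yes (ρ , _) = ρ
  ... | no _ = child ν b

  next-is : ∀ {ν b ρ} → Next ν b ρ → ρ ≡ next ν b
  next-is {ν} {b} nx with em {∃[ ρ ] Next ν b ρ}
  ... | yes (ρ , nx′) = next-unique {ν} {b} nx nx′
  ... | no none = contradiction (_ , nx) none

  next-above : ∀ ν b → (decode ν ++ b ∷ []) ⪯ decode (next ν b)
  next-above ν b with em {∃[ ρ ] Next ν b ρ}
  ... | yes (ρ , (above , _) , _) = above
  ... | no _ = subst ((decode ν ++ b ∷ []) ⪯_) (sym (decode-encode _)) ⪯-refl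

  ≼-next : ∀ ν b → ν ≼ next ν b
  ≼-next ν b = ⪯-trans (b ∷ [] , refl) (next-above ν b)

  next-correct : ∀ {ν} → t ≼ ν → ∀ b → Next ν b (next ν b)
  next-correct {ν} t≼ν b = subst (Next ν b) (next-is {ν} {b} nx) nx
    where
    child-dec = decode-encode (decode ν ++ b ∷ [])
    found : ∃[ ρ ] Extends ν b ρ
    found with dense {child ν b} (subst (decode t ⪯_) (sym child-dec) (⪯-trans {decode t} t≼ν (b ∷ [] , refl)))
    ... | ρ , c≼ρ , eq = ρ , subst (_⪯ decode ρ) child-dec c≼ρ , eq
    E? : Decidable (Extends ν b)
    E? ρ = em
    l = least E? (suc (proj₁ found))
    nx : Next ν b l
    nx = proj₂ (least-holds E? (suc (proj₁ found)) ≤-refl (proj₂ found)) ,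
         proj₁ (least-spec E? (suc (proj₁ found)))

  next-> : ∀ ν b → ν < next ν b
  next-> ν b = subst₂ _<_ (encode-decode ν) (encode-decode (next ν b))
    (<-≤-trans grow (⪯⇒encode≤ (next-above ν b)))
    where
    positive : ∀ b → 1 ≤ encode (b ∷ [])
    positive false = s≤s z≤n
    positive true = s≤s z≤n
    s = decode ν
    grow : encode s < encode (s ++ b ∷ [])
    grow = subst (encode s <_) (sym (encode-++ s (b ∷ [])))
      (m<m+n (encode s) (*-mono-≤ (m^n>0 2 (length s)) (positive b)))

  branch-unique : ∀ s {b b′ u} → (s ++ b ∷ []) ⪯ u → (s ++ b′ ∷ []) ⪯ u → b ≡ b′
  branch-unique s {b} {b′} (r , eq) (r′ , eq′) = proj₁ (∷-injective (++-cancelˡ s (b ∷ r) (b′ ∷ r′)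
    (trans (sym (++-assoc s (b ∷ []) r)) (trans eq (trans (sym eq′) (++-assoc s (b′ ∷ []) r′))))))

  climb : ℕ → List Bool → ℕ
  climb ν [] = ν
  climb ν (b ∷ σ) = climb (next ν b) σ

  climb-++ : ∀ ν σ τ → climb ν (σ ++ τ) ≡ climb (climb ν σ) τ
  climb-++ ν [] τ = refl
  climb-++ ν (b ∷ σ) τ = climb-++ (next ν b) σ τ

  ≼-climb : ∀ ν σ → ν ≼ climb ν σ
  ≼-climb ν [] = ⪯-refl
  ≼-climb ν (b ∷ σ) = ⪯-trans {decode ν} (≼-next ν b) (≼-climb (next ν b) σ)

  -- Every step raises the code, so a member is reached in at most as many steps as its code. This
  -- justifies the bound in `memberᵗ`.
  climb-length : ∀ ν σ → length σ + ν ≤ climb ν σ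
  climb-length ν [] = ≤-refl
  climb-length ν (b ∷ σ) = ≤-trans (≤-reflexive (sym (+-suc (length σ) ν)))
    (≤-trans (+-monoʳ-≤ (length σ) (next-> ν b)) (climb-length (next ν b) σ))

  climb-colour : ∀ ν σ → t ≼ ν → x ν ≡ x t → x (climb ν σ) ≡ x t
  climb-colour ν [] _ eq = eq
  climb-colour ν (b ∷ σ) t≼ν _ = climb-colour (next ν b) σ
    (⪯-trans {decode t} t≼ν (≼-next ν b)) (proj₂ (proj₁ (next-correct t≼ν b)))

  climb-mono : ∀ ν {σ τ} → σ ⪯ τ → climb ν σ ≼ climb ν τ
  climb-mono ν {σ} (r , refl) = subst (climb ν σ ≼_) (sym (climb-++ ν σ r)) (≼-climb (climb ν σ) r)

  -- Distinct first bits send the images into incompatible branches, and a nonempty address cannot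
  -- lead to a prefix of its starting node because codes grow.
  climb-reflects : ∀ ν σ τ → climb ν σ ≼ climb ν τ → σ ⪯ τ
  climb-reflects ν [] τ _ = τ , refl
  climb-reflects ν (b ∷ σ) [] le = contradiction
    (≤-trans (≼⇒≤ (next ν b) ν (⪯-trans {decode (next ν b)} (≼-climb (next ν b) σ) le)) ≤-refl)
    (<⇒≱ (next-> ν b))
  climb-reflects ν (b ∷ σ) (b′ ∷ τ) le
    with branch-unique (decode ν) {b} {b′}
           (⪯-trans (next-above ν b) (⪯-trans {decode (next ν b)} (≼-climb (next ν b) σ) le))
           (⪯-trans (next-above ν b′) (≼-climb (next ν b′) τ))
  ... | refl with climb-reflects (next ν b) σ τ le
  ...   | r , eq = r , cong (b ∷_) eq

  extends-sound : ∀ ν b ρ → Holds extendsᶠ (ρ ∷ ν ∷ encode (b ∷ []) ∷ t ∷ []) → Extends ν b ρ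
  extends-sound ν b ρ (pre , eq) =
    subst (_⪯ decode ρ) (decode-append ν (b ∷ [])) (prefix-sound x _ ρ pre) , eq

  extends-complete : ∀ ν b ρ → Extends ν b ρ → Holds extendsᶠ (ρ ∷ ν ∷ encode (b ∷ []) ∷ t ∷ [])
  extends-complete ν b ρ (pre , eq) =
    prefix-complete x _ ρ (subst (_⪯ decode ρ) (sym (decode-append ν (b ∷ []))) pre) , eq

  opaque
    unfolding nextᶠ

    next-sound : ∀ ν b ρ → Holds nextᶠ (ρ ∷ ν ∷ encode (b ∷ []) ∷ t ∷ []) → Next ν b ρ
    next-sound ν b ρ (e , none) =
      extends-sound ν b ρ e , λ ρ′ lt e′ → none (ρ′ , lt , extends-complete ν b ρ′ e′)

    next-complete : ∀ ν b ρ → Next ν b ρ → Holds nextᶠ (ρ ∷ ν ∷ encode (b ∷ []) ∷ t ∷ [])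
    next-complete ν b ρ (e , none) =
      extends-complete ν b ρ e , λ (ρ′ , lt , e′) → none ρ′ lt (extends-sound ν b ρ′ e′)

  Advance : ℕ → ℕ → ℕ → Set
  Advance ν ρ ρ′ = ρ′ ≼ ρ × (∃[ b ] Next ν b ρ′)

  opaque
    unfolding advanceᶠ

    advance-sound : ∀ ν ρ ρ′ → Holds advanceᶠ (ρ′ ∷ ν ∷ ρ ∷ t ∷ []) → Advance ν ρ ρ′
    advance-sound ν ρ ρ′ (pre , 0 , _ , h) = prefix-sound x ρ′ ρ pre , false , next-sound ν false ρ′ h
    advance-sound ν ρ ρ′ (pre , 1 , _ , h) = prefix-sound x ρ′ ρ pre , true , next-sound ν true ρ′ h
    advance-sound ν ρ ρ′ (pre , suc (suc _) , s≤s (s≤s ()) , h)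

    advance-complete : ∀ ν ρ ρ′ → Advance ν ρ ρ′ → Holds advanceᶠ (ρ′ ∷ ν ∷ ρ ∷ t ∷ [])
    advance-complete ν ρ ρ′ (pre , false , nx) =
      prefix-complete x ρ′ ρ pre , 0 , s≤s z≤n , next-complete ν false ρ′ nx
    advance-complete ν ρ ρ′ (pre , true , nx) =
      prefix-complete x ρ′ ρ pre , 1 , s≤s (s≤s z≤n) , next-complete ν true ρ′ nx

  advance : ℕ → ℕ → ℕ
  advance ν ρ = ⟦ advanceᵗ ⟧ (ν ∷ ρ ∷ t ∷ [])

  A? : ∀ ν ρ → Decidable (λ ρ′ → Holds advanceᶠ (ρ′ ∷ ν ∷ ρ ∷ t ∷ []))
  A? ν ρ ρ′ = holds? advanceᶠ (ρ′ ∷ ν ∷ ρ ∷ t ∷ [])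

  -- The two bits lead to incomparable nodes, so at most one next node is a prefix of the target
  -- `ρ`, and the search must find it.
  advance-next : ∀ {ν b ρ} → t ≼ ν → next ν b ≼ ρ → advance ν ρ ≡ next ν b
  advance-next {ν} {b} {ρ} t≼ν le = trans (choose-yes (exists<? (A? ν ρ) (suc ρ)) (_ , lt , here))
    (unique (advance-sound ν ρ _ (proj₂ (least-holds (A? ν ρ) (suc ρ) lt here))))
    where
    lt : next ν b < suc ρ
    lt = s≤s (≼⇒≤ (next ν b) ρ le)
    here = advance-complete ν ρ (next ν b) (le , b , next-correct t≼ν b)
    unique : ∀ {ρ′} → Advance ν ρ ρ′ → ρ′ ≡ next ν b
    unique {ρ′} (le′ , b′ , nx)
      with branch-unique (decode ν) {b} {b′} (⪯-trans (next-above ν b) le)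
             (⪯-trans (proj₁ (proj₁ nx)) le′)
    ... | refl = next-is {ν} {b} nx

  advance-range : ∀ ν ρ → advance ν ρ ≡ ν ⊎ (∃[ b ] advance ν ρ ≡ next ν b)
  advance-range ν ρ with exists<? (A? ν ρ) (suc ρ)
  ... | no _ = inj₁ refl
  ... | yes (_ , lt , h) with advance-sound ν ρ _ (proj₂ (least-holds (A? ν ρ) (suc ρ) lt h))
  ...   | _ , b , nx = inj₂ (b , next-is {ν} {b} nx)

  walk : ℕ → ℕ → ℕ
  walk l ρ = ⟦ walkᵗ ⟧ (l ∷ ρ ∷ t ∷ [])

  opaque
    unfolding walkᵗ

    walk-zero : ∀ ρ → walk 0 ρ ≡ t
    walk-zero ρ = refl

    walk-suc : ∀ l ρ → walk (suc l) ρ ≡ advance (walk l ρ) ρ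
    walk-suc l ρ = refl

  -- Valid for any target, inside the tree or not: a walk never leaves the tree, so arriving at `ρ`
  -- proves membership.
  walk-range : ∀ l ρ → ∃[ σ ] walk l ρ ≡ climb t σ
  walk-range zero ρ = [] , walk-zero ρ
  walk-range (suc l) ρ with walk-range l ρ | advance-range (walk l ρ) ρ
  ... | σ , eq | inj₁ same = σ , trans (walk-suc l ρ) (trans same eq)
  ... | σ , eq | inj₂ (b , step) = σ ++ b ∷ [] ,
    trans (walk-suc l ρ) (trans step (trans (cong (λ ν → next ν b) eq) (sym (climb-++ t σ (b ∷ [])))))

  -- The step count `l` and the current node `ν` are general so that the induction can consume `σ`
  -- from the front while the target stays fixed.
  walk-reaches : ∀ l ν σ {ρ} → walk l ρ ≡ ν → t ≼ ν → climb ν σ ≡ ρ → walk (length σ + l) ρ ≡ ρ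
  walk-reaches l ν [] eq _ end = trans eq end
  walk-reaches l ν (b ∷ σ) {ρ} eq t≼ν end = subst (λ m → walk m ρ ≡ ρ) (+-suc (length σ) l)
    (walk-reaches (suc l) (next ν b) σ
      (trans (walk-suc l ρ) (trans (cong (λ μ → advance μ ρ) eq)
        (advance-next {ν} {b} t≼ν (subst (next ν b ≼_) end (≼-climb (next ν b) σ)))))
      (⪯-trans {decode t} t≼ν (≼-next ν b)) end)

  member : ℕ → ℕ
  member ρ = ⟦ memberᵗ ⟧ (ρ ∷ t ∷ [])

  opaque
    unfolding memberᵗ

    member≤1 : ∀ ρ → member ρ ≤ 1
    member≤1 ρ with holds? (some (lit 1 ⊞ v0) (call walkᵗ (v0 ∷ v1 ∷ v2 ∷ []) ≐ v1)) (ρ ∷ t ∷ [])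
    ... | yes _ = ≤-refl
    ... | no _ = z≤n

    member-sound : ∀ ρ → member ρ ≡ 1 → ∃[ σ ] climb t σ ≡ ρ
    member-sound ρ eq with holds? (some (lit 1 ⊞ v0) (call walkᵗ (v0 ∷ v1 ∷ v2 ∷ []) ≐ v1)) (ρ ∷ t ∷ [])
    member-sound ρ eq | yes (l , _ , end) = let (σ , reach) = walk-range l ρ in σ , trans (sym reach) end
    member-sound ρ () | no _

    member-complete : ∀ σ → member (climb t σ) ≡ 1
    member-complete σ = choose-yes
      (holds? (some (lit 1 ⊞ v0) (call walkᵗ (v0 ∷ v1 ∷ v2 ∷ []) ≐ v1)) (climb t σ ∷ t ∷ []))
      (length σ + 0 , s≤s (≤-trans (+-monoʳ-≤ (length σ) z≤n) (climb-length t σ)) ,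
       walk-reaches 0 t σ (walk-zero _) ⪯-refl refl)

  solution : ∀ k → TTSolution k x member
  solution k = member≤1 , (h , inH , onto , order) , x t , colour
    where
    h : List Bool → List Bool
    h σ = decode (climb t σ)
    inH : ∀ σ → h σ ∈H member
    inH σ = trans (cong member (encode-decode (climb t σ))) (member-complete σ)
    onto : ∀ τ → τ ∈H member → ∃[ σ ] h σ ≡ τ
    onto τ τ∈H with member-sound (encode τ) τ∈H
    ... | σ , eq = σ , trans (cong decode eq) (decode-encode τ)
    order : ∀ σ τ → (σ ⪯ τ) ⇔ (h σ ⪯ h τ)
    order σ τ = mk⇔ (climb-mono t) (climb-reflects t σ τ)
    colour : ∀ σ → σ ∈H member → x (encode σ) ≡ x t
    colour σ σ∈H with member-sound (encode σ) σ∈H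
    ... | τ , eq = trans (cong x (sym eq)) (climb-colour t τ ⪯-refl refl)

-- The reduction

double-≡ : ∀ x y n → (x ⊕ y) (n + n) ≡ x n
double-≡ x y zero = refl
double-≡ x y (suc n) rewrite +-suc n n = double-≡ (λ m → x (suc m)) (λ m → y (suc m)) n

double+1-≡ : ∀ x y n → (x ⊕ y) (suc (n + n)) ≡ y n
double+1-≡ x y zero = refl
double+1-≡ x y (suc n) rewrite +-suc n n = double+1-≡ (λ m → x (suc m)) (λ m → y (suc m)) n

doubleᶜ leftᶜ rightᶜ : Code 1
doubleᶜ = comp plusᶜ (proj 0F ∷ proj 0F ∷ [])
leftᶜ = comp orc (doubleᶜ ∷ [])
rightᶜ = comp orc (comp succ (doubleᶜ ∷ []) ∷ [])

e-left : ∀ x y → Computes leftᶜ (x ⊕ y) x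
e-left x y n = subst (Eval (x ⊕ y) leftᶜ (n ∷ [])) (double-≡ x y n)
  (e-comp (e-comp (e-proj ∷ e-proj ∷ []) (e-plus n n) ∷ []) e-orc)

e-right : ∀ x y → Computes rightᶜ (x ⊕ y) y
e-right x y n = subst (Eval (x ⊕ y) rightᶜ (n ∷ [])) (double+1-≡ x y n)
  (e-comp (e-comp (e-comp (e-proj ∷ e-proj ∷ []) (e-plus n n) ∷ []) e-succ ∷ []) e-orc)

-- `d` is the distance to a known zero and serves as fuel; the search may stop at an earlier zero,
-- hence the new witness `v`.
mu-finds : ∀ {α n} {f : Code (suc n)} {u : ℕ → ℕ} → (∀ i ρ → Eval α f (i ∷ ρ) (u i)) →
  ∀ d i → u (d + i) ≡ 0 → ∃[ v ] u v ≡ 0 × (∀ ρ → EvalMu α f ρ i v)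
mu-finds {α} {f = f} {u} ok d i hit with u i in eq
... | zero = i , eq , λ ρ → mu-here (subst (Eval α f (i ∷ ρ)) eq (ok i ρ))
mu-finds ok zero i hit | suc r = contradiction (trans (sym eq) hit) λ ()
mu-finds {α} {f = f} {u} ok (suc d) i hit | suc r
  with mu-finds ok d (suc i) (trans (cong u (+-suc d i)) hit)
... | v , uv≡0 , found = v , uv≡0 , λ ρ → mu-next (subst (Eval α f (i ∷ ρ)) eq (ok i ρ)) (found ρ)

-- The least element of `y`, by the only unbounded search of the reduction: `1 ∸ y i` vanishes
-- exactly at the members.
elementᶜ : Code 1
elementᶜ = mu (comp isZeroᶜ (comp rightᶜ (proj 0F ∷ []) ∷ []))

element-finds : ∀ x y → IsSetCode y → (∃[ m ] m ∈ˢ y) →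
  ∃[ m ] m ∈ˢ y × (∀ n → Eval (x ⊕ y) elementᶜ (n ∷ []) m)
element-finds x y y≤1 (m , m∈y)
  with mu-finds {x ⊕ y} {1} {u = λ i → 1 ∸ y i}
         (λ i ρ → e-comp (e-comp (e-proj ∷ []) (e-right x y i) ∷ []) (e-isZero (y i)))
         m 0 (cong (1 ∸_) (trans (cong y (+-identityʳ m)) m∈y))
... | v , v∈y , found = v , ≤-antisym (y≤1 v) (m∸n≡0⇒m≤n v∈y) , λ n → e-mu (found (n ∷ []))

treeᵗ : ℕ → Tm 2
treeᵗ k = call memberᵗ (v0 ∷ call (towerᵗ (suc k)) (lit k ∷ v1 ∷ []) ∷ [])

theorem4p8 : ExcludedMiddle 0ℓ → (k : ℕ) → 1 ≤ k → TT≤WD2 k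
theorem4p8 em (suc k) _ =
  -- Both functionals are explicit codes; excluded middle enters only in verifying them.
  Compile.compile orc (levelᵗ k) ,
  -- Finds an element `m` of the homogeneous set, computes `T k m` from it and decides membership in
  -- the tree grown from that node.
  comp (Compile.compile leftᶜ (treeᵗ k)) (proj 0F ∷ elementᶜ ∷ []) ,
  λ x x≤k → let open Levels em x k x≤k in
    level , (λ n → compile-ok (λ _ → e-orc) (levelᵗ k) (n ∷ [])) , level-instance ,
    λ y sol@(y≤1 , infinite , _) →
      let (a , _ , a∈y) = infinite 0
          (m , m∈y , found) = element-finds x y y≤1 (a , a∈y)
          open Subtree em x (T k m) (λ {τ} → top-dense {y} {m} sol m∈y {τ})
      in member ,
         (λ n → e-comp (e-proj ∷ found n ∷ []) (compile-ok (e-left x y) (treeᵗ k) (n ∷ m ∷ []))) ,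
         solution (suc k)
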